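{- Let $\mathcal{A}$ be an antimatroid with convex dimension two. Then the set of basic words of $\mathcal{A}$ contains a double ladder, and $\mathcal{A}$ is balanced.
   Context: An antimatroid is a finite family $\mathcal{A}$ of finite sets that is closed under unions and accessible (for every nonempty $T\in\mathcal{A}$ there is $x\in T$ with $T\setminus\{x\}\in\mathcal{A}$). Its elements are the members of $\bigcup\mathcal{A}$. A basic word of $\mathcal{A}$ is a permutation of its elements such that the set of elements of every prefix belongs to $\mathcal{A}$. A chain antimatroid is an antimatroid with exactly one basic word. The join of antimatroids $\mathcal{A}_1,\dots,\mathcal{A}_m$ is $\{A_1\cup\dots\cup A_m : A_i\in\mathcal{A}_i\}$; the convex dimension of $\mathcal{A}$ is the minimum number of chain antimatroids whose join is $\mathcal{A}$. For elements $x\ne y$, $\Pr[x<y]$ is the probability that $x$ precedes $y$ in a uniformly random basic word. A balanced pair is a pair with $\frac13\le\Pr[x<y]\le\frac23$; $\mathcal{A}$ is balanced if it contains a balanced pair or is a chain antimatroid. For a set $\Omega$ of orderings (here, the basic words), an element $x$ and a nonempty sequence $Y=(y_0,\dots,y_{k-1})$ of distinct elements, $(x,Y)$ is a ladder if: (1) in every ordering of $\Omega$, the elements of $Y$ occurring earlier than $x$ occur in the order of $Y$; (2) whenever $w\in\Omega$ has some elements of $Y$ earlier than $x$ and $i$ is the largest index with $y_i$ earlier than $x$ in $w$, swapping $x$ and $y_i$ in $w$ yields an ordering in $\Omega$. A double ladder is a pair of nonempty sequences $X=(x_0,\dots)$, $Y=(y_0,\dots)$ such that $(x_0,Y)$ and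 $(y_0,X)$ are both ladders. -}

module Defs where

open import Level using (0ℓ)
open import Data.Nat using (ℕ; _≤_; _*_; _<_)
open import Data.Fin using (Fin; _≟_)
import Data.Fin as F
open import Data.Fin.Subset using (Subset; _∈_; _∉_; _∪_; _-_; ⁅_⁆; Nonempty)
import Data.Fin.Subset as S
open import Data.List using (List; []; _∷_; length; lookup; take; map; foldr)
open import Data.List.Relation.Unary.Unique.Propositional using (Unique)
open import Data.List.Relation.Unary.All using (All)
import Data.List.Membership.Propositional as LM
open import Data.Product using (Σ; ∃; ∃-syntax; _×_; _,_)
open import Data.Sum using (_⊎_)
open import Relation.Nullary using (¬_; yes; no)
open import Relation.Unary using (Pred)
open import Relation.Binary.PropositionalEquality using (_≡_)
open import Function.Bundles using (_⇔_)

-- A family of subsets of the ground set Fin n, given as a predicate on subsets.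
-- (Any finite family of finite sets can be relabelled to live inside some Fin n.)
Family : ℕ → Set₁
Family n = Pred (Subset n) 0ℓ

module _ {n : ℕ} where

  setOf : List (Fin n) → Subset n
  setOf = foldr (λ x S → ⁅ x ⁆ ∪ S) S.⊥

  UnionClosed : Family n → Set
  UnionClosed 𝒜 = ∀ A B → 𝒜 A → 𝒜 B → 𝒜 (A ∪ B)

  Accessible : Family n → Set
  Accessible 𝒜 = ∀ T → 𝒜 T → Nonempty T → ∃[ x ] (x ∈ T × 𝒜 (T - x))

  IsAntimatroid : Family n → Set
  IsAntimatroid 𝒜 = UnionClosed 𝒜 × Accessible 𝒜

  Element : Family n → Fin n → Set
  Element 𝒜 x = ∃[ T ] (𝒜 T × x ∈ T)

  IsBasicWord : Family n → List (Fin n) → Set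
  IsBasicWord 𝒜 w =
    Unique w
    × (∀ x → (x LM.∈ w) ⇔ Element 𝒜 x)
    × (∀ k → k ≤ length w → 𝒜 (setOf (take k w)))

  IsChainAntimatroid : Family n → Set
  IsChainAntimatroid 𝒜 =
    IsAntimatroid 𝒜 × ∃[ w ] (IsBasicWord 𝒜 w × (∀ v → IsBasicWord 𝒜 v → v ≡ w))

  Join : Family n → Family n → Family n
  Join 𝒜₁ 𝒜₂ S = ∃[ A₁ ] ∃[ A₂ ] (𝒜₁ A₁ × 𝒜₂ A₂ × S ≡ A₁ ∪ A₂)

  SameFamily : Family n → Family n → Set
  SameFamily 𝒜 ℬ = ∀ S → 𝒜 S ⇔ ℬ S

  -- convex dimension exactly two: 𝒜 is the join of two chain antimatroids,
  -- but not the join of at most one chain antimatroid.  (The join of zero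
  -- antimatroids is {∅}, itself a chain antimatroid, and the join of one
  -- chain antimatroid is that chain antimatroid.)
  ConvexDimensionTwo : Family n → Set₁
  ConvexDimensionTwo 𝒜 =
    (∃[ 𝒞₁ ] ∃[ 𝒞₂ ] (IsChainAntimatroid 𝒞₁ × IsChainAntimatroid 𝒞₂
                        × SameFamily 𝒜 (Join 𝒞₁ 𝒞₂)))
    × ¬ (∃[ 𝒞 ] (IsChainAntimatroid 𝒞 × SameFamily 𝒜 𝒞))

  Precedes : Fin n → Fin n → List (Fin n) → Set
  Precedes x y w =
    ∃[ i ] ∃[ j ] (i F.< j × lookup w i ≡ x × lookup w j ≡ y)

  swap : Fin n → Fin n → List (Fin n) → List (Fin n)
  swap a b = map f
    where
    f : Fin n → Fin n
    f z with z ≟ a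
    ... | yes _ = b
    ... | no _ with z ≟ b
    ...   | yes _ = a
    ...   | no _ = z

  IsLadder : Pred (Fin n) 0ℓ → Pred (List (Fin n)) 0ℓ → Fin n → List (Fin n) → Set
  IsLadder E Ω x Y =
    E x × All E Y × Unique Y × ¬ (x LM.∈ Y) × ¬ (Y ≡ [])
    × (∀ w → Ω w → (i j : Fin (length Y)) → i F.< j →
         Precedes (lookup Y i) x w → Precedes (lookup Y j) x w →
         Precedes (lookup Y i) (lookup Y j) w)
    × (∀ w → Ω w → (i : Fin (length Y)) →
         Precedes (lookup Y i) x w →
         (∀ j → i F.< j → ¬ Precedes (lookup Y j) x w) →
         Ω (swap x (lookup Y i) w))

  IsDoubleLadder : Pred (Fin n) 0ℓ → Pred (List (Fin n)) 0ℓ → List (Fin n) → List (Fin n) → Set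
  IsDoubleLadder E Ω [] Y = Data.Empty.⊥ where import Data.Empty
  IsDoubleLadder E Ω (x₀ ∷ X) [] = Data.Empty.⊥ where import Data.Empty
  IsDoubleLadder E Ω (x₀ ∷ X) (y₀ ∷ Y) =
    IsLadder E Ω x₀ (y₀ ∷ Y) × IsLadder E Ω y₀ (x₀ ∷ X)

  HasDoubleLadder : Family n → Set
  HasDoubleLadder 𝒜 = ∃[ X ] ∃[ Y ] IsDoubleLadder (Element 𝒜) (IsBasicWord 𝒜) X Y

  Enumerates : Pred (List (Fin n)) 0ℓ → List (List (Fin n)) → Set
  Enumerates P L = Unique L × (∀ w → (w LM.∈ L) ⇔ P w)

  -- 1/3 ≤ Pr[x < y] ≤ 2/3, where Pr[x < y] = |{basic words with x before y}|
  -- / |{basic words}|; written as  N ≤ 3 M ≤ 2 N.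
  BalancedPair : Family n → Fin n → Fin n → Set
  BalancedPair 𝒜 x y =
    ∃[ L ] ∃[ Lxy ]
      ( Enumerates (IsBasicWord 𝒜) L
      × Enumerates (λ w → IsBasicWord 𝒜 w × Precedes x y w) Lxy
      × length L ≤ 3 * length Lxy
      × 3 * length Lxy ≤ 2 * length L )

  IsBalanced : Family n → Set
  IsBalanced 𝒜 =
    (∃[ x ] ∃[ y ] (Element 𝒜 x × Element 𝒜 y × ¬ (x ≡ y) × BalancedPair 𝒜 x y))
    ⊎ IsChainAntimatroid 𝒜

{-# OPTIONS --safe #-}
module Submission where

-- A chain antimatroid consists of the prefixes of its unique basic word, so 𝒜
-- consists of the unions of a prefix of P and a prefix of Q for two basic words
-- P and Q of 𝒜 (each chain's word is completed by the missing elements in the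
-- order of the other).  Since 𝒜 is not a chain, P = c x … and Q = c y … for a
-- common prefix c and x ≠ y.  Let Y = (y, …) be the part of Q between c and x.
-- Until x occurs, a basic word can only follow Q, so it has the form c s x r
-- with s a prefix of Y, and x may be moved to any earlier place after c.  Hence
-- (x, Y) is a ladder, and symmetrically so is (y, X).
--
-- Moving x right after c is injective on the words with a given s, so with N
-- basic words and f(z) = #{x before z}, the value f grows by at most f(y) along
-- Y and finally reaches at least N - f(y).  If f(y) < N/3 it thus cannot jump
-- over [N/3, 2N/3]; if f(y) > 2N/3 the same argument applies to (y, X).

open import Defs
open import Data.Nat using (ℕ; zero; suc; _+_; _*_; _≤_; _<_; z≤n; s≤s; s≤s⁻¹)
open import Data.Nat.Properties using (≤-trans; ≤-refl; ≤-antisym; <-irrefl; <-asym; <⇒≤; ≰⇒>; ≤⇒≯; _≤?_; m≤m+n; n≤1+n; +-identityʳ; +-mono-<; +-monoˡ-≤; +-cancelˡ-≤; *-monoʳ-≤; *-monoˡ-≤; *-distribˡ-+; *-distribʳ-+; module ≤-Reasoning)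
open import Data.Fin using (Fin; zero; suc; _≟_)
import Data.Fin as F
import Data.Fin.Properties as F
import Data.Fin.Subset as S
import Data.Fin.Subset.Properties as S
open import Data.Bool.Properties using () renaming (_≟_ to _≟ᵇ_)
open import Data.Vec.Properties using () renaming (≡-dec to ≡-decᵛ)
open import Data.List using (List; []; _∷_; [_]; _++_; length; lookup; take; drop; map; filter; allFin; cartesianProductWith)
open import Data.List.Properties using (++-assoc; ++-identityʳ; ++-cancelˡ; ∷-injective; ∷-injectiveʳ; length-++; length-map; take++drop≡id; filter-accept; filter-reject; length-++-sucʳ)
open import Data.List.Membership.Propositional using (_∈_; _∉_)
open import Data.List.Membership.Propositional.Properties
open import Data.List.Relation.Unary.Any using (here; there; index)
open import Data.List.Relation.Unary.Any.Properties using (¬Any[]; lookup-index)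
open import Data.List.Relation.Unary.All as All using ([]; _∷_)
open import Data.List.Relation.Unary.All.Properties using (¬Any⇒All¬)
open import Data.List.Relation.Unary.AllPairs using ([]; _∷_)
open import Data.List.Relation.Unary.Unique.Propositional using (Unique)
open import Data.List.Relation.Unary.Unique.Propositional.Properties using (Unique[x∷xs]⇒x∉xs; filter⁺; allFin⁺; cartesianProductWith⁺) renaming (++⁺ to Unique-++⁺)
open import Data.List.Relation.Binary.Subset.Propositional using (_⊆_)
open import Data.List.Relation.Binary.Permutation.Propositional using (_↭_; ↭-sym; ↭⇒↭ₛ)
open import Data.List.Relation.Binary.Permutation.Propositional.Properties using (∈-resp-↭; shift; ++⁺ˡ)
import Data.List.Relation.Binary.Permutation.Setoid.Properties as Permₛ
open import Data.Product using (∃-syntax; _×_; _,_; proj₁; proj₂)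
open import Data.Sum as Sum using (_⊎_; inj₁; inj₂; [_,_]′)
open import Function using (_∘_; id)
open import Function.Bundles using (_⇔_; mk⇔; Equivalence)
open import Relation.Nullary using (¬_; Dec; yes; no; contradiction)
open import Relation.Nullary.Decidable using (map′; _×-dec_; ¬?)
open import Relation.Unary using (Decidable)
open import Relation.Binary.PropositionalEquality using (_≡_; _≢_; refl; sym; trans; cong; cong₂; subst; setoid)

open Equivalence using (to; from)

-- Prefixes of words and equality of letter sets

module _ {A : Set} where

  _≼_ : List A → List A → Set
  p ≼ w = ∃[ r ] (w ≡ p ++ r)

  _≋_ : List A → List A → Set
  u ≋ v = u ⊆ v × v ⊆ u

  ≋-sym : ∀ {u v} → u ≋ v → v ≋ u
  ≋-sym (f , g) = g , f

  ≋-trans : ∀ {u v w} → u ≋ v → v ≋ w → u ≋ w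
  ≋-trans (f , g) (h , k) = (h ∘ f) , (g ∘ k)

  ↭⇒≋ : ∀ {u v} → u ↭ v → u ≋ v
  ↭⇒≋ π = ∈-resp-↭ π , ∈-resp-↭ (↭-sym π)

  ≼-refl : ∀ {w} → w ≼ w
  ≼-refl {w} = [] , sym (++-identityʳ w)

  ≼-trans : ∀ {u v w} → u ≼ v → v ≼ w → u ≼ w
  ≼-trans {u} (r , refl) (r′ , refl) = r ++ r′ , ++-assoc u r r′

  ≼-++ : ∀ {u v} → u ≼ (u ++ v)
  ≼-++ {v = v} = v , refl

  ≼⇒⊆ : ∀ {u v} → u ≼ v → u ⊆ v
  ≼⇒⊆ (_ , refl) = ∈-++⁺ˡ

  ++-compare : ∀ (u v a b : List A) → u ++ v ≡ a ++ b →
    (∃[ d ] (a ≡ u ++ d × v ≡ d ++ b)) ⊎ (∃[ d ] (u ≡ a ++ d × b ≡ d ++ v))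
  ++-compare []      v a       b eq = inj₁ (a , refl , eq)
  ++-compare (z ∷ u) v []      b eq = inj₂ (z ∷ u , refl , sym eq)
  ++-compare (z ∷ u) v (y ∷ a) b eq with ∷-injective eq
  ... | refl , eq′ with ++-compare u v a b eq′
  ...   | inj₁ (d , e , e′) = inj₁ (d , cong (z ∷_) e , e′)
  ...   | inj₂ (d , e , e′) = inj₂ (d , cong (z ∷_) e , e′)

  ≼-compare : ∀ {p q w} → p ≼ w → q ≼ w → p ≼ q ⊎ q ≼ p
  ≼-compare {p} {q} (r , refl) (r′ , eq) with ++-compare p r q r′ eq
  ... | inj₁ (d , e , _) = inj₁ (d , e)
  ... | inj₂ (d , e , _) = inj₂ (d , e)

  ≼-++-split : ∀ {p} a {b} → p ≼ (a ++ b) → p ≼ a ⊎ (∃[ d ] (p ≡ a ++ d × d ≼ b))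
  ≼-++-split {p} a {b} (r , eq) with ++-compare p r a b (sym eq)
  ... | inj₁ (d , e , _)  = inj₁ (d , e)
  ... | inj₂ (d , e , e′) = inj₂ (d , e , r , e′)

  ≼-++⁺ : ∀ a {p b} → p ≼ b → (a ++ p) ≼ (a ++ b)
  ≼-++⁺ a {p} (r , refl) = r , sym (++-assoc a p r)

  ≼-before : ∀ {p a x b} → p ≼ (a ++ x ∷ b) → x ∉ p → p ≼ a
  ≼-before {a = a} pre x∉p with ≼-++-split a pre
  ... | inj₁ p≼a                        = p≼a
  ... | inj₂ ([] , refl , _)            = [] , sym (trans (++-identityʳ _) (++-identityʳ a))
  ... | inj₂ (_ ∷ _ , refl , _ , refl) = contradiction (∈-++⁺ʳ a (here refl)) x∉p

  ≼-after : ∀ {p a x b} → p ≼ (a ++ x ∷ b) → x ∉ a → x ∈ p → a ≼ p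
  ≼-after {a = a} pre x∉a x∈p with ≼-++-split a pre
  ... | inj₁ p≼a            = contradiction (≼⇒⊆ p≼a x∈p) x∉a
  ... | inj₂ (d , refl , _) = ≼-++

  ≼-++-≋ : ∀ {p q w} → p ≼ w → q ≼ w → ∃[ s ] (s ≼ w × (p ++ q) ≋ s)
  ≼-++-≋ {p} {q} p≼w q≼w with ≼-compare p≼w q≼w
  ... | inj₁ p≼q = q , q≼w , [ ≼⇒⊆ p≼q , id ]′ ∘ ∈-++⁻ p , ∈-++⁺ʳ p
  ... | inj₂ q≼p = p , p≼w , [ id , ≼⇒⊆ q≼p ]′ ∘ ∈-++⁻ p , ∈-++⁺ˡ

  Unique-++⁻ : ∀ u {v : List A} → Unique (u ++ v) → Unique u × Unique v × (∀ {z} → z ∈ u → z ∉ v)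
  Unique-++⁻ []      uv       = [] , uv , λ ()
  Unique-++⁻ (a ∷ u) uv@(_ ∷ uv′) with Unique-++⁻ u uv′
  ... | uu , vv , dis = ¬Any⇒All¬ u (a∉ ∘ ∈-++⁺ˡ) ∷ uu , vv , dis′
    where
    a∉ = Unique[x∷xs]⇒x∉xs uv
    dis′ : ∀ {z} → z ∈ a ∷ u → z ∉ _
    dis′ (here refl) = a∉ ∘ ∈-++⁺ʳ u
    dis′ (there z∈)  = dis z∈

  Unique-middle : ∀ u {x} {v : List A} → Unique (u ++ x ∷ v) → x ∉ u
  Unique-middle u uxv x∈u = proj₂ (proj₂ (Unique-++⁻ u uxv)) x∈u (here refl)

  Unique-↭ : ∀ {u v : List A} → u ↭ v → Unique u → Unique v
  Unique-↭ π = Permₛ.Unique-resp-↭ (setoid A) (↭⇒↭ₛ π)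

  ≼-Unique : ∀ {p w : List A} → p ≼ w → Unique w → Unique p
  ≼-Unique {p} (_ , refl) = proj₁ ∘ Unique-++⁻ p

  ∷-⊆-cancel : ∀ {a} {u v : List A} → a ∉ u → (a ∷ u) ⊆ (a ∷ v) → u ⊆ v
  ∷-⊆-cancel a∉u sub z∈u with sub (there z∈u)
  ... | here refl = contradiction z∈u a∉u
  ... | there z∈v = z∈v

  ∷-≋-cancel : ∀ {a} {u v : List A} → a ∉ u → a ∉ v → (a ∷ u) ≋ (a ∷ v) → u ≋ v
  ∷-≋-cancel a∉u a∉v (f , g) = ∷-⊆-cancel a∉u f , ∷-⊆-cancel a∉v g

  -- The prefix `[ a ]` matches a nonempty prefix of `R` with no letter but `a`, so `R` starts with
  -- `a` as well; absence of repetitions lets `a` be stripped from all matching pairs. This recovers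
  -- the order of a word from the sets of its prefixes, the only data that a family records.
  prefixes-≋⇒≼ : ∀ {u R : List A} → Unique u → Unique R →
    (∀ v → v ≼ u → ∃[ s ] (s ≼ R × v ≋ s)) → u ≼ R
  prefixes-≋⇒≼ {[]}    {R} _ _ _ = R , refl
  prefixes-≋⇒≼ {a ∷ u} {R} uu uR h with h [ a ] ≼-++
  ... | [] , _ , f , _ = contradiction (f (here refl)) ¬Any[]
  ... | b ∷ s , (R′ , refl) , f , g with g (here refl)
  ...   | here refl with prefixes-≋⇒≼ {u} {s ++ R′} (tail uu) (tail uR) h′
    where
    tail : ∀ {z} {v : List A} → Unique (z ∷ v) → Unique v
    tail (_ ∷ v) = v
    h′ : ∀ v → v ≼ u → ∃[ t ] (t ≼ (s ++ R′) × v ≋ t)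
    h′ v (r , refl) with h (a ∷ v) (r , refl)
    ... | [] , _ , f′ , _ = contradiction (f′ (here refl)) ¬Any[]
    ... | _ ∷ t , (r′ , eq) , av≋at with ∷-injective eq
    ...   | refl , eq′ = t , (r′ , eq′) ,
      ∷-≋-cancel (Unique[x∷xs]⇒x∉xs uu ∘ ∈-++⁺ˡ)
                 (λ a∈t → Unique[x∷xs]⇒x∉xs uR (subst (a ∈_) (sym eq′) (∈-++⁺ˡ a∈t))) av≋at
  ...     | r , eq = r , cong (a ∷_) eq

  ≼-⊇⇒≡ : ∀ {p w : List A} → Unique w → p ≼ w → w ⊆ p → w ≡ p
  ≼-⊇⇒≡ {p} _  ([]    , refl) _  = ++-identityʳ p
  ≼-⊇⇒≡ {p} uw (z ∷ r , refl) w⊆ = contradiction (w⊆ (∈-++⁺ʳ p (here refl))) (Unique-middle p uw)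

  first-difference : (∀ x y → Dec (x ≡ y)) → ∀ {u v : List A} → Unique u → Unique v → u ≋ v →
    u ≡ v ⊎ (∃[ c ] ∃[ x ] ∃[ y ] ∃[ u′ ] ∃[ v′ ] (u ≡ c ++ x ∷ u′ × v ≡ c ++ y ∷ v′ × x ≢ y))
  first-difference _   {[]}    {[]}    _ _ _ = inj₁ refl
  first-difference _   {[]}    {y ∷ v} _ _ (_ , g) = contradiction (g (here refl)) ¬Any[]
  first-difference _   {x ∷ u} {[]}    _ _ (f , _) = contradiction (f (here refl)) ¬Any[]
  first-difference dec {x ∷ u} {y ∷ v} uu@(_ ∷ uu′) uv@(_ ∷ uv′) eq with dec x y
  ... | no x≢y  = inj₂ ([] , x , y , u , v , refl , refl , x≢y)
  ... | yes refl with first-difference dec uu′ uv′ (∷-≋-cancel (Unique[x∷xs]⇒x∉xs uu) (Unique[x∷xs]⇒x∉xs uv) eq)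
  ...   | inj₁ e = inj₁ (cong (x ∷_) e)
  ...   | inj₂ (c , a , b , u′ , v′ , e , e′ , a≢b) =
    inj₂ (x ∷ c , a , b , u′ , v′ , cong (x ∷_) e , cong (x ∷_) e′ , a≢b)

  any-prefix? : {B : List A → Set} → (∀ p → Dec (B p)) → ∀ w → Dec (∃[ p ] (p ≼ w × B p))
  any-prefix? B? w with B? []
  ... | yes b = yes ([] , (w , refl) , b)
  any-prefix? B? [] | no ¬b = no λ { ([] , _ , b) → ¬b b ; (_ ∷ _ , (_ , ()) , _) }
  any-prefix? B? (a ∷ w) | no ¬b = map′
    (λ { (p , (r , e) , b) → a ∷ p , (r , cong (a ∷_) e) , b })
    (λ { ([] , _ , b) → contradiction b ¬b
       ; (_ ∷ p , (r , refl) , b) → p , (r , refl) , b })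
    (any-prefix? (B? ∘ (a ∷_)) w)

  all-prefixes? : {B : List A → Set} → (∀ p → Dec (B p)) → ∀ w → Dec (∀ p → p ≼ w → B p)
  all-prefixes? {B} B? w with any-prefix? (¬? ∘ B?) w
  ... | yes (p , p≼w , ¬b) = no λ h → ¬b (h p p≼w)
  ... | no ¬any = yes holds
    where
    holds : ∀ p → p ≼ w → B p
    holds p p≼w with B? p
    ... | yes b = b
    ... | no ¬b = contradiction (p , p≼w , ¬b) ¬any

-- A relation stands in for an injective function, since in `step` the image of a word depends on a
-- case analysis. The image `b` of the head is removed from `vs`; injectivity keeps the other images
-- in the rest.
length-injection : ∀ {A B : Set} {R : A → B → Set} {us : List A} {vs : List B} → Unique us →
  (∀ {a} → a ∈ us → ∃[ b ] (b ∈ vs × R a b)) → (∀ {a a′ b} → R a b → R a′ b → a ≡ a′) →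
  length us ≤ length vs
length-injection {us = []} _ _ _ = z≤n
length-injection {R = R} {us = a ∷ us} uu@(_ ∷ uu′) h inj with h (here refl)
... | b , b∈vs , Rab with ∈-∃++ b∈vs
...   | vs₁ , vs₂ , refl = subst (suc (length us) ≤_) (sym (length-++-sucʳ vs₁ b vs₂))
  (s≤s (length-injection {R = R} uu′ h′ inj))
  where
  h′ : ∀ {a′} → a′ ∈ us → ∃[ b′ ] (b′ ∈ vs₁ ++ vs₂ × R a′ b′)
  h′ a′∈us with h (there a′∈us)
  ... | b′ , b′∈ , Ra′b′ with ∈-resp-↭ (shift b vs₁ vs₂) b′∈
  ...   | here refl with refl ← inj Rab Ra′b′ = contradiction a′∈us (Unique[x∷xs]⇒x∉xs uu)
  ...   | there b′∈′ = b′ , b′∈′ , Ra′b′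


length-⊆ : ∀ {A : Set} {us vs : List A} → Unique us → us ⊆ vs → length us ≤ length vs
length-⊆ uu us⊆vs = length-injection {R = _≡_} uu (λ z∈ → _ , us⊆vs z∈ , refl) λ { refl refl → refl }

-- Feasible words and basic words

module _ {n : ℕ} where

  open import Data.List.Relation.Unary.Unique.DecPropositional (_≟_ {n}) using (unique?)
  open import Data.List.Membership.DecPropositional (_≟_ {n}) using (_∈?_)

  ∈-setOf⁺ : ∀ {z : Fin n} {u} → z ∈ u → z S.∈ setOf u
  ∈-setOf⁺ {z} (here refl) = S.x∈p∪q⁺ (inj₁ (S.x∈⁅x⁆ z))
  ∈-setOf⁺ (there z∈u) = S.x∈p∪q⁺ (inj₂ (∈-setOf⁺ z∈u))

  ∈-setOf⁻ : ∀ {z : Fin n} u → z S.∈ setOf u → z ∈ u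
  ∈-setOf⁻ [] z∈ = contradiction z∈ S.∉⊥
  ∈-setOf⁻ (a ∷ u) z∈ with S.x∈p∪q⁻ S.⁅ a ⁆ (setOf u) z∈
  ... | inj₁ z∈a = here (S.x∈⁅y⁆⇒x≡y a z∈a)
  ... | inj₂ z∈u = there (∈-setOf⁻ u z∈u)

  setOf-cong : ∀ {u v : List (Fin n)} → u ≋ v → setOf u ≡ setOf v
  setOf-cong {u} {v} (f , g) =
    S.⊆-antisym (∈-setOf⁺ ∘ f ∘ ∈-setOf⁻ u) (∈-setOf⁺ ∘ g ∘ ∈-setOf⁻ v)

  setOf-injective : ∀ {u v : List (Fin n)} → setOf u ≡ setOf v → u ≋ v
  setOf-injective {u} {v} eq =
    (λ z∈ → ∈-setOf⁻ v (subst (_ S.∈_) eq (∈-setOf⁺ z∈))) ,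
    (λ z∈ → ∈-setOf⁻ u (subst (_ S.∈_) (sym eq) (∈-setOf⁺ z∈)))

  setOf-++ : ∀ (u v : List (Fin n)) → setOf (u ++ v) ≡ setOf u S.∪ setOf v
  setOf-++ u v = S.⊆-antisym
    (λ z∈ → S.x∈p∪q⁺ (Sum.map ∈-setOf⁺ ∈-setOf⁺ (∈-++⁻ u (∈-setOf⁻ (u ++ v) z∈))))
    (λ z∈ → ∈-setOf⁺ ([ ∈-++⁺ˡ ∘ ∈-setOf⁻ u , ∈-++⁺ʳ u ∘ ∈-setOf⁻ v ]′ (S.x∈p∪q⁻ _ _ z∈)))

  -- The prefix condition of `IsBasicWord`, with factorisations in place of `take k`; it also makes
  -- sense for words that miss some elements.
  Feasible : Family n → List (Fin n) → Set
  Feasible 𝒜 w = ∀ p → p ≼ w → 𝒜 (setOf p)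

  take-length-++ : ∀ (p r : List (Fin n)) → take (length p) (p ++ r) ≡ p
  take-length-++ []      r = refl
  take-length-++ (a ∷ p) r = cong (a ∷_) (take-length-++ p r)

  basic⇒Unique : ∀ {𝒜 : Family n} {w} → IsBasicWord 𝒜 w → Unique w
  basic⇒Unique = proj₁

  basic-∈⇔ : ∀ {𝒜 : Family n} {w} → IsBasicWord 𝒜 w → ∀ {z} → (z ∈ w) ⇔ Element 𝒜 z
  basic-∈⇔ b {z} = proj₁ (proj₂ b) z

  basic⇒Feasible : ∀ {𝒜 : Family n} {w} → IsBasicWord 𝒜 w → Feasible 𝒜 w
  basic⇒Feasible {𝒜} (_ , _ , h) p (r , refl) = subst (𝒜 ∘ setOf) (take-length-++ p r)
    (h (length p) (subst (length p ≤_) (sym (length-++ p)) (m≤m+n _ _)))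

  basic : ∀ {𝒜 : Family n} {w} → Unique w → (∀ {z} → (z ∈ w) ⇔ Element 𝒜 z) → Feasible 𝒜 w → IsBasicWord 𝒜 w
  basic {w = w} uw el fw = uw , (λ z → el) , λ k _ → fw _ (drop k w , sym (take++drop≡id k w))

  Feasible⇒Element : ∀ {𝒜 : Family n} {w z} → Feasible 𝒜 w → z ∈ w → Element 𝒜 z
  Feasible⇒Element {w = w} fw z∈w = setOf w , fw w ≼-refl , ∈-setOf⁺ z∈w

  basic-≋ : ∀ {𝒜 : Family n} {v w} → IsBasicWord 𝒜 v → IsBasicWord 𝒜 w → v ≋ w
  basic-≋ bv bw = from (basic-∈⇔ bw) ∘ to (basic-∈⇔ bv) , from (basic-∈⇔ bv) ∘ to (basic-∈⇔ bw)

  basic-resp : ∀ {𝒜 : Family n} {v w} → IsBasicWord 𝒜 v → Unique w → w ≋ v → Feasible 𝒜 w → IsBasicWord 𝒜 w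
  basic-resp bv uw (f , g) fw = basic uw (mk⇔ (to (basic-∈⇔ bv) ∘ f) (g ∘ from (basic-∈⇔ bv))) fw

  -- Completing one word by another

  ext : List (Fin n) → List (Fin n) → List (Fin n)
  ext u v = u ++ filter (λ z → ¬? (z ∈? u)) v

  ext-≋ : ∀ u v → ext u v ≋ (u ++ v)
  ext-≋ u v = f , g
    where
    f : ext u v ⊆ (u ++ v)
    f z∈ with ∈-++⁻ u z∈
    ... | inj₁ z∈u = ∈-++⁺ˡ z∈u
    ... | inj₂ z∈v = ∈-++⁺ʳ u (proj₁ (∈-filter⁻ (λ z → ¬? (z ∈? u)) {xs = v} z∈v))
    g : (u ++ v) ⊆ ext u v
    g {z} z∈ with z ∈? u
    ... | yes z∈u = ∈-++⁺ˡ z∈u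
    ... | no  z∉u with ∈-++⁻ u z∈
    ...   | inj₁ z∈u = ∈-++⁺ˡ z∈u
    ...   | inj₂ z∈v = ∈-++⁺ʳ u (∈-filter⁺ (λ z → ¬? (z ∈? u)) z∈v z∉u)

  ext-Unique : ∀ {u v} → Unique u → Unique v → Unique (ext u v)
  ext-Unique {u} {v} uu uv = Unique-++⁺ uu (filter⁺ _ uv)
    λ (z∈u , z∈v) → proj₂ (∈-filter⁻ (λ z → ¬? (z ∈? u)) {xs = v} z∈v) z∈u

  ≼-filter : {B : Fin n → Set} (B? : Decidable B) → ∀ v {d} → d ≼ filter B? v → ∃[ t ] (t ≼ v × d ≡ filter B? t)
  ≼-filter B? []      {[]} _ = [] , ≼-refl , refl
  ≼-filter B? (a ∷ v) {d} pre with B? a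
  ≼-filter B? (a ∷ v) {[]}    pre | yes _ = [] , (_ , refl) , refl
  ≼-filter B? (a ∷ v) {_ ∷ d} (r , eq) | yes b with ∷-injective eq
  ... | refl , eq′ with ≼-filter B? v (r , eq′)
  ...   | t , (r′ , refl) , refl = a ∷ t , (r′ , refl) , sym (filter-accept B? b)
  ≼-filter B? (a ∷ v) {d}     pre | no ¬b with ≼-filter B? v pre
  ... | t , (r′ , refl) , refl = a ∷ t , (r′ , refl) , sym (filter-reject B? ¬b)

  -- A prefix reaching past `u` has the letters of `u` together with those of a prefix `t` of `v`:
  -- what the filter drops from `t` is in `u` anyway. Hence its set is a union of two members of
  -- `𝒜`.
  ext-Feasible : ∀ {𝒜 : Family n} {u v} → UnionClosed 𝒜 → Feasible 𝒜 u → Feasible 𝒜 v → Feasible 𝒜 (ext u v)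
  ext-Feasible {𝒜} {u} {v} ∪-closed fu fv p p≼ with ≼-++-split u p≼
  ... | inj₁ p≼u = fu p p≼u
  ... | inj₂ (d , refl , d≼) with ≼-filter (λ z → ¬? (z ∈? u)) v d≼
  ...   | t , t≼v , refl = subst 𝒜 (trans (sym (setOf-++ u t)) (setOf-cong (≋-sym (ext-≋ u t))))
          (∪-closed _ _ (fu u ≼-refl) (fv t t≼v))

  -- Chain antimatroids and the two spanning words

  -- Accessibility removes one letter at a time, and the removed letters are written from right to
  -- left, so every prefix is a set met on the way down. The bound `k` on the size makes the
  -- recursion structural.
  accessible-word : ∀ {𝒜 : Family n} → Accessible 𝒜 → ∀ k T → S.∣ T ∣ ≤ k → 𝒜 T →
    ∃[ u ] (Unique u × Feasible 𝒜 u × T ≡ setOf u)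
  accessible-word {𝒜} acc k T ∣T∣≤k aT with S.nonempty? T
  ... | no empty = [] , [] , (λ { [] _ → subst 𝒜 T≡⊥ aT ; (_ ∷ _) (_ , ()) }) , T≡⊥
    where T≡⊥ = S.Empty-unique empty
  ... | yes ne with acc T aT ne
  accessible-word acc zero T ∣T∣≤k aT | yes ne | x , x∈T , _ with ≤-trans (S.x∈p⇒∣p-x∣<∣p∣ x∈T) ∣T∣≤k
  ... | ()
  accessible-word {𝒜} acc (suc k) T ∣T∣≤k aT | yes ne | x , x∈T , aT-x
    with accessible-word acc k (T S.- x) (s≤s⁻¹ (≤-trans (S.x∈p⇒∣p-x∣<∣p∣ x∈T) ∣T∣≤k)) aT-x
  ... | u , uu , fu , eq = u ++ [ x ] , Unique-++⁺ uu ([] ∷ []) disj , feas , T≡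
    where
    disj : ∀ {z} → ¬ (z ∈ u × z ∈ [ x ])
    disj (z∈u , here refl) = x∉T-x (subst (x S.∈_) (sym eq) (∈-setOf⁺ z∈u))
      where
      x∉T-x : x S.∉ (T S.- x)
      -- Deleting `x` twice equals deleting it once, yet deleting a member lowers the size.
      x∉T-x x∈ = <-irrefl (cong S.∣_∣ (S.p─q─q≡p─q T S.⁅ x ⁆)) (S.x∈p⇒∣p-x∣<∣p∣ x∈)
    T≡ : T ≡ setOf (u ++ [ x ])
    T≡ = S.⊆-antisym f g
      where
      f : T S.⊆ setOf (u ++ [ x ])
      f {z} z∈T with z ≟ x
      ... | yes refl = ∈-setOf⁺ (∈-++⁺ʳ u (here refl))
      ... | no z≢x = ∈-setOf⁺ (∈-++⁺ˡ (∈-setOf⁻ u (subst (z S.∈_) eq (S.x∈p∧x≢y⇒x∈p-y z∈T z≢x))))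
      g : setOf (u ++ [ x ]) S.⊆ T
      g z∈ with ∈-++⁻ u (∈-setOf⁻ (u ++ [ x ]) z∈)
      ... | inj₁ z∈u = S.p─q⊆p T S.⁅ x ⁆ (subst (_ S.∈_) (sym eq) (∈-setOf⁺ z∈u))
      ... | inj₂ (here refl) = x∈T
    feas : Feasible 𝒜 (u ++ [ x ])
    feas p p≼ with ≼-++-split u p≼
    ... | inj₁ p≼u = fu p p≼u
    ... | inj₂ ([] , refl , _) = subst 𝒜 (trans eq (cong setOf (sym (++-identityʳ u)))) aT-x
    ... | inj₂ (_ ∷ [] , refl , (_ , refl)) = subst 𝒜 T≡ aT
    ... | inj₂ (_ ∷ _ ∷ _ , refl , (_ , ()))

  -- Completing a word for `T` by `w` gives a basic word, which by uniqueness is `w` itself; so the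
  -- word for `T` is a prefix of `w`.
  chain-sets : ∀ {𝒞 : Family n} (ch : IsChainAntimatroid 𝒞) {T} → 𝒞 T → ∃[ p ] (p ≼ proj₁ (proj₂ ch) × T ≡ setOf p)
  chain-sets {𝒞} ((∪-closed , acc) , w , bw , unique) {T} cT with accessible-word acc _ T ≤-refl cT
  ... | u , uu , fu , T≡ = u , (_ , sym (unique (ext u w) b)) , T≡
    where
    fe : Feasible 𝒞 (ext u w)
    fe = ext-Feasible ∪-closed fu (basic⇒Feasible bw)
    b : IsBasicWord 𝒞 (ext u w)
    b = basic (ext-Unique uu (basic⇒Unique bw))
          (mk⇔ (Feasible⇒Element fe) (λ e → proj₂ (ext-≋ u w) (∈-++⁺ʳ u (from (basic-∈⇔ bw) e)))) fe

  Spanned : List (Fin n) → List (Fin n) → S.Subset n → Set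
  Spanned P Q T = ∃[ p ] (p ≼ P × ∃[ q ] (q ≼ Q × T ≡ setOf (p ++ q)))

  Spanned-sym : ∀ {P Q T} → Spanned P Q T → Spanned Q P T
  Spanned-sym (p , p≼ , q , q≼ , T≡) =
    q , q≼ , p , p≼ , trans T≡ (trans (setOf-++ p q) (trans (S.∪-comm _ _) (sym (setOf-++ q p))))

  -- The words `w₁` and `w₂` of the chains may miss elements of `𝒜`, so each is completed by the
  -- other. Spanning survives because prefixes of `w₁` and `w₂` remain prefixes of the completed
  -- words.
  join-spanned : ∀ {𝒜 𝒞₁ 𝒞₂ : Family n} → UnionClosed 𝒜 → IsChainAntimatroid 𝒞₁ → IsChainAntimatroid 𝒞₂ →
    SameFamily 𝒜 (Join 𝒞₁ 𝒞₂) →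
    ∃[ P ] ∃[ Q ] (IsBasicWord 𝒜 P × IsBasicWord 𝒜 Q × (∀ {T} → 𝒜 T → Spanned P Q T))
  join-spanned {𝒜} {𝒞₁} {𝒞₂} ∪-closed ch₁@(_ , w₁ , b₁ , _) ch₂@(_ , w₂ , b₂ , _) same =
    ext w₁ w₂ , ext w₂ w₁ ,
    basic (ext-Unique (basic⇒Unique b₁) (basic⇒Unique b₂))
      (mk⇔ (Feasible⇒Element fP) (proj₂ (ext-≋ w₁ w₂) ∘ el)) fP ,
    basic (ext-Unique (basic⇒Unique b₂) (basic⇒Unique b₁))
      (mk⇔ (Feasible⇒Element fQ) (proj₂ (ext-≋ w₂ w₁) ∘ [ ∈-++⁺ʳ w₂ , ∈-++⁺ˡ ]′ ∘ ∈-++⁻ w₁ ∘ el)) fQ ,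
    λ aT → let p , p≼ , q , q≼ , T≡ = spanned aT in
      p , ≼-trans p≼ ≼-++ , q , ≼-trans q≼ ≼-++ , T≡
    where
    -- Each chain contains the empty set, as the empty prefix of its word, so every set of the other
    -- chain lies in the join.
    f₁ : Feasible 𝒜 w₁
    f₁ p p≼ = from (same _) (setOf p , S.⊥ , basic⇒Feasible b₁ p p≼ ,
      basic⇒Feasible b₂ [] (w₂ , refl) , sym (S.∪-identityʳ _))
    f₂ : Feasible 𝒜 w₂
    f₂ p p≼ = from (same _) (S.⊥ , setOf p , basic⇒Feasible b₁ [] (w₁ , refl) ,
      basic⇒Feasible b₂ p p≼ , sym (S.∪-identityˡ _))
    fP : Feasible 𝒜 (ext w₁ w₂)
    fP = ext-Feasible ∪-closed f₁ f₂
    fQ : Feasible 𝒜 (ext w₂ w₁)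
    fQ = ext-Feasible ∪-closed f₂ f₁
    spanned : ∀ {T} → 𝒜 T → Spanned w₁ w₂ T
    spanned aT with to (same _) aT
    ... | A₁ , A₂ , c₁ , c₂ , T≡ with chain-sets ch₁ c₁ | chain-sets ch₂ c₂
    ...   | p , p≼ , refl | q , q≼ , refl = p , p≼ , q , q≼ , trans T≡ (sym (setOf-++ p q))
    el : ∀ {z} → Element 𝒜 z → z ∈ w₁ ++ w₂
    el (T , aT , z∈T) with spanned aT
    ... | p , p≼ , q , q≼ , refl with ∈-++⁻ p (∈-setOf⁻ (p ++ q) z∈T)
    ...   | inj₁ z∈p = ∈-++⁺ˡ (≼⇒⊆ p≼ z∈p)
    ...   | inj₂ z∈q = ∈-++⁺ʳ w₁ (≼⇒⊆ q≼ z∈q)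

  -- Any two prefixes of a single word are comparable, so the sets spanned by
  -- (P, P) are the prefixes of P.
  spanned-diagonal⇒chain : ∀ {𝒜 : Family n} {P} → IsAntimatroid 𝒜 → IsBasicWord 𝒜 P →
    (∀ {T} → 𝒜 T → Spanned P P T) → IsChainAntimatroid 𝒜
  spanned-diagonal⇒chain {𝒜} {P} am bP span = am , P , bP , only
    where
    only : ∀ v → IsBasicWord 𝒜 v → v ≡ P
    only v bv = sym (≼-⊇⇒≡ (basic⇒Unique bP) v≼P (proj₂ (basic-≋ bv bP)))
      where
      pre : ∀ p → p ≼ v → ∃[ s ] (s ≼ P × p ≋ s)
      pre p p≼v with span (basic⇒Feasible bv p p≼v)
      ... | p₁ , p₁≼ , p₂ , p₂≼ , eq with ≼-++-≋ p₁≼ p₂≼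
      ...   | s , s≼ , ≋s = s , s≼ , ≋-trans (setOf-injective eq) ≋s
      v≼P = prefixes-≋⇒≼ (basic⇒Unique bv) (basic⇒Unique bP) pre

  -- Enumerating the basic words

  words : ℕ → List (List (Fin n))
  words zero    = [ [] ]
  words (suc k) = cartesianProductWith _∷_ (allFin n) (words k)

  words-Unique : ∀ k → Unique (words k)
  words-Unique zero    = [] ∷ []
  words-Unique (suc k) = cartesianProductWith⁺ _∷_ ∷-injective (allFin⁺ n) (words-Unique k)

  ∈-words : ∀ w → w ∈ words (length w)
  ∈-words []      = here refl
  ∈-words (a ∷ w) = ∈-cartesianProductWith⁺ _∷_ (∈-allFin a) (∈-words w)

  Unique-≋-length : ∀ {u v : List (Fin n)} → Unique u → Unique v → u ≋ v → length u ≡ length v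
  Unique-≋-length uu uv (f , g) = ≤-antisym (length-⊆ uu f) (length-⊆ uv g)

  basic-enumeration : ∀ {𝒜 : Family n} {P Q} → UnionClosed 𝒜 → IsBasicWord 𝒜 P → IsBasicWord 𝒜 Q →
    (∀ {T} → 𝒜 T → Spanned P Q T) → ∃[ L ] Enumerates (IsBasicWord 𝒜) L
  basic-enumeration {𝒜} {P} {Q} ∪-closed bP bQ span =
    filter basic? (words (length P)) , filter⁺ basic? (words-Unique (length P)) ,
    λ w → mk⇔ (proj₂ ∘ ∈-filter⁻ basic? {xs = words (length P)})
      (λ bw → ∈-filter⁺ basic?
        (subst (λ k → w ∈ words k) (Unique-≋-length (basic⇒Unique bw) (basic⇒Unique bP) (basic-≋ bw bP)) (∈-words w)) bw)
    where
    _≟ˢ_ : ∀ (S T : S.Subset n) → Dec (S ≡ T)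
    _≟ˢ_ = ≡-decᵛ _≟ᵇ_
    -- `𝒜` is an arbitrary predicate; it becomes decidable because membership amounts to being the
    -- union of a prefix of `P` and a prefix of `Q`, which a finite search settles.
    𝒜? : ∀ p → Dec (𝒜 (setOf p))
    𝒜? u = map′
      (λ (p , p≼ , q , q≼ , eq) → subst 𝒜 (trans (sym (setOf-++ p q)) (sym eq))
        (∪-closed _ _ (basic⇒Feasible bP p p≼) (basic⇒Feasible bQ q q≼)))
      span
      (any-prefix? (λ p → any-prefix? (λ q → setOf u ≟ˢ setOf (p ++ q)) Q) P)
    basic? : ∀ w → Dec (IsBasicWord 𝒜 w)
    basic? w = map′
      (λ (uw , eq , fw) → basic-resp bP uw (setOf-injective eq) fw)
      (λ bw → basic⇒Unique bw , setOf-cong (basic-≋ bw bP) , basic⇒Feasible bw)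
      (unique? w ×-dec setOf w ≟ˢ setOf P ×-dec all-prefixes? 𝒜? w)

  -- Precedence and transposition of letters

  precedes? : ∀ x y (w : List (Fin n)) → Dec (Precedes x y w)
  precedes? x y w = F.any? λ i → F.any? λ j → i F.<? j ×-dec lookup w i ≟ x ×-dec lookup w j ≟ y

  lookup-injective : ∀ {w : List (Fin n)} → Unique w → ∀ i j → lookup w i ≡ lookup w j → i ≡ j
  lookup-injective {_ ∷ _} uw zero zero _ = refl
  lookup-injective {a ∷ w} uw zero (suc j) eq =
    contradiction (subst (_∈ w) (sym eq) (∈-lookup j)) (Unique[x∷xs]⇒x∉xs uw)
  lookup-injective {a ∷ w} uw (suc i) zero eq =
    contradiction (subst (_∈ w) eq (∈-lookup i)) (Unique[x∷xs]⇒x∉xs uw)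
  lookup-injective {_ ∷ _} (_ ∷ uw) (suc i) (suc j) eq = cong suc (lookup-injective uw i j eq)

  precedes-asym : ∀ {a b} {w : List (Fin n)} → Unique w → Precedes a b w → ¬ Precedes b a w
  precedes-asym uw (i , j , i<j , refl , refl) (i′ , j′ , i′<j′ , e , e′)
    with refl ← lookup-injective uw i′ j e | refl ← lookup-injective uw j′ i e′ = <-asym i<j i′<j′

  precedes-∷ : ∀ {a b z} {w : List (Fin n)} → Precedes a b w → Precedes a b (z ∷ w)
  precedes-∷ (i , j , i<j , e , e′) = suc i , suc j , s≤s i<j , e , e′

  precedes-after : ∀ {x z : Fin n} u {r} → z ∈ r → Precedes x z (u ++ x ∷ r)
  precedes-after []      z∈r = zero , suc (index z∈r) , s≤s z≤n , refl , sym (lookup-index z∈r)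
  precedes-after (_ ∷ u) z∈r = precedes-∷ (precedes-after u z∈r)

  precedes-before : ∀ {x y : Fin n} u {r} → y ∈ u → Precedes y x (u ++ x ∷ r)
  precedes-before (_ ∷ u) (here refl) = precedes-after [] (∈-insert u)
  precedes-before (_ ∷ u) (there y∈u) = precedes-∷ (precedes-before u y∈u)

  precedes⇒∈ : ∀ {x y : Fin n} u {r} → Unique (u ++ x ∷ r) → Precedes y x (u ++ x ∷ r) → y ∈ u
  precedes⇒∈ []      uw (i , suc j , i<j , e , e′) =
    contradiction (subst (_∈ _) e′ (∈-lookup j)) (Unique[x∷xs]⇒x∉xs uw)
  precedes⇒∈ (z ∷ u) uw (zero , _ , _ , e , _) = here (sym e)
  precedes⇒∈ (z ∷ u) (_ ∷ uw) (suc i , suc j , i<j , e , e′) =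
    there (precedes⇒∈ u uw (i , j , s≤s⁻¹ i<j , e , e′))

  swap-fresh : ∀ {x y : Fin n} u {v} → x ∉ u → y ∉ u → swap x y (u ++ v) ≡ u ++ swap x y v
  swap-fresh [] _ _ = refl
  swap-fresh {x} {y} (z ∷ u) x∉ y∉ with z ≟ x
  ... | yes refl = contradiction (here refl) x∉
  ... | no _ with z ≟ y
  ...   | yes refl = contradiction (here refl) y∉
  ...   | no _ = cong (z ∷_) (swap-fresh u (x∉ ∘ there) (y∉ ∘ there))

  swap-pair : ∀ {x y : Fin n} {r} → x ≢ y → swap x y (y ∷ x ∷ r) ≡ x ∷ y ∷ swap x y r
  swap-pair {x} {y} x≢y with y ≟ x
  ... | yes refl = contradiction refl x≢y
  ... | no _ with y ≟ y
  ...   | no y≢y = contradiction refl y≢y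
  ...   | yes _ with x ≟ x
  ...     | no x≢x = contradiction refl x≢x
  ...     | yes _ = refl

  -- `swap` relabels every occurrence of the two letters; without repetitions only the two adjacent
  -- entries change.
  swap-adjacent : ∀ {x y : Fin n} u {r} → Unique (u ++ y ∷ x ∷ r) → swap x y (u ++ y ∷ x ∷ r) ≡ u ++ x ∷ y ∷ r
  swap-adjacent {x} {y} u {r} uw = trans (swap-fresh u (λ x∈u → u#yxr x∈u (there (here refl))) (Unique-middle u uw))
    (cong (u ++_) (trans (swap-pair λ { refl → y∉xr (here refl) })
      (cong (λ v → x ∷ y ∷ v) swap-r)))
    where
    uyxr : Unique (y ∷ x ∷ r)
    uyxr = proj₁ (proj₂ (Unique-++⁻ u uw))
    u#yxr : ∀ {z} → z ∈ u → z ∉ y ∷ x ∷ r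
    u#yxr = proj₂ (proj₂ (Unique-++⁻ u uw))
    y∉xr : y ∉ x ∷ r
    y∉xr = Unique[x∷xs]⇒x∉xs uyxr
    x∉r : x ∉ r
    x∉r with _ ∷ uxr ← uyxr = Unique[x∷xs]⇒x∉xs uxr
    swap-r : swap x y r ≡ r
    swap-r = subst (λ v → swap x y v ≡ v) (++-identityʳ r)
      (swap-fresh r {[]} x∉r (y∉xr ∘ there))

  -- The basic words as seen from `x`, and its ladder

  module OneSide {𝒜 : Family n} (∪-closed : UnionClosed 𝒜) {P Q : List (Fin n)}
    (bP : IsBasicWord 𝒜 P) (bQ : IsBasicWord 𝒜 Q) (span : ∀ {T} → 𝒜 T → Spanned P Q T)
    (c : List (Fin n)) (x : Fin n) (P′ Y Q′ : List (Fin n))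
    (P≡ : P ≡ c ++ x ∷ P′) (Q≡ : Q ≡ c ++ Y ++ x ∷ Q′) where

    cY≼Q : (c ++ Y) ≼ Q
    cY≼Q = x ∷ Q′ , trans Q≡ (sym (++-assoc c Y _))

    Unique-cY : Unique (c ++ Y)
    Unique-cY = ≼-Unique cY≼Q (basic⇒Unique bQ)

    Unique-Y : Unique Y
    Unique-Y = proj₁ (proj₂ (Unique-++⁻ c Unique-cY))

    Y∉c : ∀ {z} → z ∈ Y → z ∉ c
    Y∉c z∈Y z∈c = proj₂ (proj₂ (Unique-++⁻ c Unique-cY)) z∈c z∈Y

    x∉c : x ∉ c
    x∉c = Unique-middle c (subst Unique P≡ (basic⇒Unique bP))

    x∉cY : x ∉ c ++ Y
    x∉cY = Unique-middle (c ++ Y) (subst Unique (proj₂ cY≼Q) (basic⇒Unique bQ))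

    x∉Y : x ∉ Y
    x∉Y = x∉cY ∘ ∈-++⁺ʳ c

    Element-x : Element 𝒜 x
    Element-x = to (basic-∈⇔ bP) (subst (x ∈_) (sym P≡) (∈-insert c))

    Element-Y : ∀ {z} → z ∈ Y → Element 𝒜 z
    Element-Y z∈Y = to (basic-∈⇔ bQ) (≼⇒⊆ cY≼Q (∈-++⁺ʳ c z∈Y))

    -- Until x occurs, P contributes nothing beyond c, so the word has to follow Q.
    structure : ∀ {w} → IsBasicWord 𝒜 w → ∃[ s ] (s ≼ Y × ∃[ r ] (w ≡ (c ++ s) ++ x ∷ r))
    structure {w} bw with ∈-∃++ (from (basic-∈⇔ bw) Element-x)
    ... | u , r , refl = split
      where
      x∉u : x ∉ u
      x∉u = Unique-middle u (basic⇒Unique bw)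
      prefixes : ∀ v → v ≼ u → ∃[ s ] (s ≼ (c ++ Y) × v ≋ s)
      prefixes v v≼u with span (basic⇒Feasible bw v (≼-trans v≼u ≼-++))
      ... | p , p≼ , q , q≼ , eq with ≼-++-≋ (≼-trans p≼c ≼-++) q≼cY
        where
        v≋ = setOf-injective eq
        p≼c : p ≼ c
        p≼c = ≼-before (subst (p ≼_) P≡ p≼) (λ x∈p → x∉u (≼⇒⊆ v≼u (proj₂ v≋ (∈-++⁺ˡ x∈p))))
        q≼cY : q ≼ (c ++ Y)
        q≼cY = ≼-before (subst (q ≼_) (proj₂ cY≼Q) q≼) (λ x∈q → x∉u (≼⇒⊆ v≼u (proj₂ v≋ (∈-++⁺ʳ p x∈q))))
      ...   | s , s≼ , ≋s = s , s≼ , ≋-trans (setOf-injective eq) ≋s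
      u≼cY : u ≼ (c ++ Y)
      u≼cY = prefixes-≋⇒≼ (proj₁ (Unique-++⁻ u (basic⇒Unique bw))) Unique-cY prefixes
      c⊆u : c ⊆ u
      -- The prefix is taken up to and including `x`: whichever of `p` and `q` supplies `x` has
      -- already passed the whole of `c`.
      c⊆u z∈c with span (basic⇒Feasible bw (u ++ [ x ]) (r , sym (++-assoc u [ x ] r)))
      ... | p , p≼ , q , q≼ , eq with ∈-++⁻ u (proj₂ (setOf-injective {u ++ [ x ]} eq) z∈pq)
        where
        z∈pq : _ ∈ p ++ q
        z∈pq with ∈-++⁻ p (proj₁ (setOf-injective {u ++ [ x ]} eq) (∈-++⁺ʳ u (here refl)))
        ... | inj₁ x∈p = ∈-++⁺ˡ (≼⇒⊆ (≼-after (subst (p ≼_) P≡ p≼) x∉c x∈p) z∈c)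
        ... | inj₂ x∈q = ∈-++⁺ʳ p (≼⇒⊆ (≼-after (subst (q ≼_) (proj₂ cY≼Q) q≼) x∉cY x∈q) (∈-++⁺ˡ z∈c))
      ...   | inj₁ z∈u         = z∈u
      ...   | inj₂ (here refl) = contradiction z∈c x∉c
      split : ∃[ s ] (s ≼ Y × ∃[ r′ ] (u ++ x ∷ r ≡ (c ++ s) ++ x ∷ r′))
      split with ≼-++-split c u≼cY
      ... | inj₂ (s , refl , s≼Y) = s , s≼Y , r , refl
      ... | inj₁ u≼c = [] , (Y , refl) , r ,
        cong (_++ x ∷ r) (sym (trans (++-identityʳ c) (≼-⊇⇒≡ (proj₁ (Unique-++⁻ c Unique-cY)) u≼c c⊆u)))

    -- A prefix within `c ++ s` is a prefix of `Q`. If it contains the moved `x` and ends within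
    -- `a`, its set is the union of the prefix `c ++ [ x ]` of `P` and a prefix of `Q`. Beyond `a`,
    -- it has the same letters as a prefix of the original word.
    move-earlier : ∀ s a r → (s ++ a) ≼ Y →
      IsBasicWord 𝒜 ((c ++ s ++ a) ++ x ∷ r) → IsBasicWord 𝒜 ((c ++ s) ++ x ∷ a ++ r)
    move-earlier s a r sa≼Y bw = basic-resp bw (Unique-↭ (π r) (basic⇒Unique bw)) (≋-sym (↭⇒≋ (π r))) feas
      where
      π : ∀ r → (c ++ s ++ a) ++ x ∷ r ↭ (c ++ s) ++ x ∷ a ++ r
      π r = subst (_↭ (c ++ s) ++ x ∷ a ++ r)
        (trans (sym (++-assoc (c ++ s) a (x ∷ r))) (cong (_++ x ∷ r) (++-assoc c s a)))
        (++⁺ˡ (c ++ s) (shift x a r))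
      Q-prefix : ∀ {p} → p ≼ (c ++ s ++ a) → 𝒜 (setOf p)
      Q-prefix p≼ = basic⇒Feasible bQ _ (≼-trans p≼ (≼-trans (≼-++⁺ c sa≼Y) cY≼Q))
      cs≼ : (c ++ s) ≼ (c ++ s ++ a)
      cs≼ = a , sym (++-assoc c s a)
      feas : Feasible 𝒜 ((c ++ s) ++ x ∷ a ++ r)
      feas p p≼ with ≼-++-split (c ++ s) p≼
      ... | inj₁ p≼cs = Q-prefix (≼-trans p≼cs cs≼)
      ... | inj₂ ([] , refl , _) = Q-prefix (subst (_≼ (c ++ s ++ a)) (sym (++-identityʳ (c ++ s))) cs≼)
      ... | inj₂ (_ ∷ d , refl , (t , eq)) with ∷-injective eq
      ...   | refl , eq′ with ≼-++-split {p = d} a (t , eq′)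
      ...     | inj₁ (t′ , refl) = subst 𝒜 (trans (sym (setOf-++ (c ++ [ x ]) (c ++ s ++ d))) (setOf-cong (f , g)))
                (∪-closed _ _ (basic⇒Feasible bP (c ++ [ x ]) (P′ , trans P≡ (sym (++-assoc c [ x ] P′))))
                  (Q-prefix (≼-++⁺ c (≼-++⁺ s (t′ , refl)))))
        where
        f : ((c ++ [ x ]) ++ c ++ s ++ d) ⊆ ((c ++ s) ++ x ∷ d)
        f z∈ with ∈-++⁻ (c ++ [ x ]) z∈
        ... | inj₁ z∈cx = [ ∈-++⁺ˡ ∘ ∈-++⁺ˡ , (λ { (here refl) → ∈-insert (c ++ s) }) ]′ (∈-++⁻ c z∈cx)
        ... | inj₂ z∈csd = [ ∈-++⁺ˡ ∘ ∈-++⁺ˡ , [ ∈-++⁺ˡ ∘ ∈-++⁺ʳ c , ∈-++⁺ʳ (c ++ s) ∘ there ]′ ∘ ∈-++⁻ s ]′ (∈-++⁻ c z∈csd)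
        g : ((c ++ s) ++ x ∷ d) ⊆ ((c ++ [ x ]) ++ c ++ s ++ d)
        g z∈ with ∈-++⁻ (c ++ s) z∈
        ... | inj₁ z∈cs = ∈-++⁺ʳ (c ++ [ x ]) (≼⇒⊆ (d , sym (++-assoc c s d)) z∈cs)
        ... | inj₂ (here refl) = ∈-++⁺ˡ (∈-insert c)
        ... | inj₂ (there z∈d) = ∈-++⁺ʳ (c ++ [ x ]) (∈-++⁺ʳ c (∈-++⁺ʳ s z∈d))
      ...     | inj₂ (d′ , refl , (t′ , refl)) = subst 𝒜 (setOf-cong (↭⇒≋ (π d′)))
                (basic⇒Feasible bw ((c ++ s ++ a) ++ x ∷ d′) (t′ , sym (++-assoc (c ++ s ++ a) (x ∷ d′) t′)))

    before⇒∈ : ∀ {s r z} → z ∈ Y → IsBasicWord 𝒜 ((c ++ s) ++ x ∷ r) →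
      Precedes z x ((c ++ s) ++ x ∷ r) → z ∈ s
    before⇒∈ {s} z∈Y bw pr =
      [ (λ z∈c → contradiction z∈c (Y∉c z∈Y)) , id ]′ (∈-++⁻ c (precedes⇒∈ (c ++ s) (basic⇒Unique bw) pr))

    -- By `structure`, the letters of `Y` before `x` are those of a prefix `s` of `Y`, which gives
    -- their order. The one of largest index is the last letter of `s`, adjacent to `x`, and the
    -- swap is `move-earlier` across a single letter.
    ladder : Y ≢ [] → IsLadder (Element 𝒜) (IsBasicWord 𝒜) x Y
    ladder Y≢[] = Element-x , All.tabulate Element-Y , Unique-Y , x∉Y , Y≢[] , ordered , swappable
      where
      ordered : ∀ w → IsBasicWord 𝒜 w → (i j : Fin (length Y)) → i F.< j →
        Precedes (lookup Y i) x w → Precedes (lookup Y j) x w → Precedes (lookup Y i) (lookup Y j) w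
      ordered w bw i j i<j pi pj with structure bw
      ... | s , (t , Y≡) , r , refl with ∈-∃++ (before⇒∈ {s} {r} (∈-lookup j) bw pj)
      ...   | s₁ , s₂ , refl = subst (Precedes (lookup Y i) (lookup Y j)) reassoc
              (precedes-before (c ++ s₁) (∈-++⁺ʳ c yi∈s₁))
        where
        Y≡′ : Y ≡ s₁ ++ lookup Y j ∷ s₂ ++ t
        Y≡′ = trans Y≡ (++-assoc s₁ _ t)
        yi∈s₁ : lookup Y i ∈ s₁
        yi∈s₁ = precedes⇒∈ s₁ (subst Unique Y≡′ Unique-Y)
          (subst (Precedes (lookup Y i) (lookup Y j)) Y≡′ (i , j , i<j , refl , refl))
        reassoc : (c ++ s₁) ++ lookup Y j ∷ s₂ ++ x ∷ r ≡ (c ++ s₁ ++ lookup Y j ∷ s₂) ++ x ∷ r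
        reassoc = trans (sym (++-assoc (c ++ s₁) (lookup Y j ∷ s₂) (x ∷ r))) (cong (_++ x ∷ r) (++-assoc c s₁ _))
      swappable : ∀ w → IsBasicWord 𝒜 w → (i : Fin (length Y)) → Precedes (lookup Y i) x w →
        (∀ j → i F.< j → ¬ Precedes (lookup Y j) x w) → IsBasicWord 𝒜 (swap x (lookup Y i) w)
      swappable w bw i pi last with structure bw
      ... | s , s≼Y , r , refl with ∈-∃++ (before⇒∈ {s} {r} (∈-lookup i) bw pi)
      ...   | s₁ , [] , refl = subst (IsBasicWord 𝒜)
              (sym (trans (cong (swap x (lookup Y i)) reassoc)
                (swap-adjacent (c ++ s₁) (subst Unique reassoc (basic⇒Unique bw)))))
              (move-earlier s₁ [ lookup Y i ] r s≼Y bw)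
        where
        reassoc : (c ++ s₁ ++ [ lookup Y i ]) ++ x ∷ r ≡ (c ++ s₁) ++ lookup Y i ∷ x ∷ r
        reassoc = trans (cong (_++ x ∷ r) (sym (++-assoc c s₁ _))) (++-assoc (c ++ s₁) _ (x ∷ r))
      -- A letter `z` of `s` after `lookup Y i` would be a letter of `Y` with larger index that
      -- precedes `x`, contrary to `last`.
      ...   | s₁ , z ∷ s₂ , refl with subst (Precedes (lookup Y i) z) (sym Y≡) (precedes-after s₁ (here refl))
        where
        Y≡ : Y ≡ s₁ ++ lookup Y i ∷ z ∷ s₂ ++ proj₁ s≼Y
        Y≡ = trans (proj₂ s≼Y) (++-assoc s₁ _ _)
      ...     | i′ , j , i′<j , e , refl with refl ← lookup-injective Unique-Y i′ i e =
        contradiction (precedes-before (c ++ s₁ ++ _) (∈-++⁺ʳ c (∈-++⁺ʳ s₁ (there (here refl))))) (last j i′<j)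

    -- Counting basic words and finding the balanced pair

    module Count {L : List (List (Fin n))} (L-enum : Enumerates (IsBasicWord 𝒜) L) where

      firsts : Fin n → List (List (Fin n))
      firsts z = filter (precedes? x z) L

      ∉⇒after : ∀ {s r z} → z ∈ Y → z ∉ s → IsBasicWord 𝒜 ((c ++ s) ++ x ∷ r) →
        Precedes x z ((c ++ s) ++ x ∷ r)
      ∉⇒after {s} {r} {z} z∈Y z∉s bw with ∈-++⁻ (c ++ s) (from (basic-∈⇔ bw) (Element-Y z∈Y))
      ... | inj₁ z∈cs = contradiction z∈cs ([ Y∉c z∈Y , z∉s ]′ ∘ ∈-++⁻ c)
      ... | inj₂ (here refl) = contradiction z∈Y x∉Y
      ... | inj₂ (there z∈r) = precedes-after (c ++ s) z∈r

      -- The words in which x comes directly after s ++ [ z ] inject into those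
      -- in which x comes directly after c, by moving x forward.
      step : ∀ {s z t y₀ As} → Y ≡ s ++ z ∷ t → y₀ ∈ Y → Unique As → As ⊆ L →
        (∀ {w z′ t′} → w ∈ As → t ≡ z′ ∷ t′ → Precedes x z′ w) →
        length As ≤ length (firsts z) + length (firsts y₀)
      step {s} {z} {t} {y₀} {As} Y≡ y₀∈Y uAs As⊆L stop = subst (length As ≤_)
        (trans (length-++ (map inj₁ (firsts z))) (cong₂ _+_ (length-map inj₁ (firsts z)) (length-map inj₂ (firsts y₀))))
        (length-injection {R = R} {vs = map inj₁ (firsts z) ++ map inj₂ (firsts y₀)} uAs target R-injective)
        where
        -- Words with `x` before `z` are kept, the others have `x` moved. A kept word may coincide
        -- with the image of a moved one; the tags of the sum keep them apart.
        R : List (Fin n) → List (Fin n) ⊎ List (Fin n) → Set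
        R w (inj₁ w′) = w ≡ w′
        R w (inj₂ w′) = ∃[ r ] (w ≡ (c ++ s ++ [ z ]) ++ x ∷ r × w′ ≡ (c ++ []) ++ x ∷ (s ++ [ z ]) ++ r)
        R-injective : ∀ {a a′ b} → R a b → R a′ b → a ≡ a′
        R-injective {b = inj₁ _} refl refl = refl
        R-injective {b = inj₂ _} (r , refl , refl) (r′ , refl , eq) = cong (λ r → (c ++ s ++ [ z ]) ++ x ∷ r)
          (++-cancelˡ (s ++ [ z ]) r r′ (∷-injectiveʳ (++-cancelˡ (c ++ []) (x ∷ (s ++ [ z ]) ++ r) _ eq)))
        z∈Y : z ∈ Y
        z∈Y = subst (z ∈_) (sym Y≡) (∈-insert s)
        z∉s : z ∉ s
        z∉s = Unique-middle s (subst Unique Y≡ Unique-Y)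
        target : ∀ {w} → w ∈ As → ∃[ b ] (b ∈ map inj₁ (firsts z) ++ map inj₂ (firsts y₀) × R w b)
        target {w} w∈As with to (proj₂ L-enum w) (As⊆L w∈As)
        ... | bw with structure bw
        ... | s′ , s′≼Y , r , refl with z ∈? s′
        ...   | no z∉s′ = inj₁ w , ∈-++⁺ˡ (∈-map⁺ inj₁ (∈-filter⁺ (precedes? x z) (As⊆L w∈As) (∉⇒after {s′} {r} z∈Y z∉s′ bw))) , refl
        ...   | yes z∈s′ with ≼-++-split s (subst (s′ ≼_) Y≡ s′≼Y)
        ...     | inj₁ s′≼s = contradiction (≼⇒⊆ s′≼s z∈s′) z∉s
        ...     | inj₂ ([] , refl , _) = contradiction (subst (z ∈_) (++-identityʳ s) z∈s′) z∉s
        ...     | inj₂ (_ ∷ z′ ∷ d , refl , (_ , refl)) = contradiction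
                    (precedes-before (c ++ s ++ _) (∈-++⁺ʳ c (∈-++⁺ʳ s (there (here refl)))))
                    (precedes-asym (basic⇒Unique bw) (stop w∈As refl))
        ...     | inj₂ (_ ∷ [] , refl , (_ , refl)) = inj₂ w′ ,
                    ∈-++⁺ʳ (map inj₁ (firsts z)) (∈-map⁺ inj₂ (∈-filter⁺ (precedes? x y₀) (from (proj₂ L-enum w′) bw′) (∉⇒after y₀∈Y (λ ()) bw′))) ,
                    r , refl , refl
          where
          w′ = (c ++ []) ++ x ∷ (s ++ [ z ]) ++ r
          bw′ : IsBasicWord 𝒜 w′
          bw′ = move-earlier [] (s ++ [ z ]) r s′≼Y bw

      Central : Fin n → Set
      Central z = length L ≤ 3 * length (firsts z) × 3 * length (firsts z) ≤ 2 * length L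

      -- The invariant along `Y` is that `firsts z` has at most two thirds of the words. If `z` is
      -- not central it has fewer than a third, and `step` adds fewer than another third, so the
      -- invariant passes to the next letter.
      central-from : ∀ {y₀} → y₀ ∈ Y → 3 * length (firsts y₀) < length L →
        ∀ s z t → Y ≡ s ++ z ∷ t → 3 * length (firsts z) ≤ 2 * length L → ∃[ z ] (z ∈ Y × Central z)
      central-from {y₀} y₀∈Y small s z t Y≡ upper with length L ≤? 3 * length (firsts z)
      ... | yes lower = z , subst (z ∈_) (sym Y≡) (∈-insert s) , lower , upper
      ... | no ¬lower = continue t refl
        where
        triple : ∀ {m} → m ≤ length (firsts z) + length (firsts y₀) → 3 * m < 2 * length L
        triple {m} m≤ = begin-strict
          3 * m                                             ≤⟨ *-monoʳ-≤ 3 m≤ ⟩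
          3 * (length (firsts z) + length (firsts y₀))      ≡⟨ *-distribˡ-+ 3 (length (firsts z)) _ ⟩
          3 * length (firsts z) + 3 * length (firsts y₀)    <⟨ +-mono-< (≰⇒> ¬lower) small ⟩
          length L + length L                               ≡⟨ cong (length L +_) (sym (+-identityʳ _)) ⟩
          2 * length L                                      ∎
          where open ≤-Reasoning
        continue : ∀ t′ → t ≡ t′ → ∃[ z ] (z ∈ Y × Central z)
        -- At the end of `Y` the condition `stop` is vacuous, so `step` applies to all of `L` and
        -- would bound its length by less than two thirds of itself.
        continue [] refl = contradiction (triple (step Y≡ y₀∈Y (proj₁ L-enum) id λ _ ()))
          (≤⇒≯ (*-monoˡ-≤ (length L) (n≤1+n 2)))
        continue (z′ ∷ t′) refl = central-from y₀∈Y small (s ++ [ z ]) z′ t′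
          (trans Y≡ (sym (++-assoc s [ z ] _)))
          (<⇒≤ (triple (step Y≡ y₀∈Y (filter⁺ (precedes? x z′) (proj₁ L-enum))
            (proj₁ ∘ ∈-filter⁻ (precedes? x z′))
            λ { w∈ refl → proj₂ (∈-filter⁻ (precedes? x z′) {xs = L} w∈) })))

      -- If `y₀` is not central, its count lies below a third; it then serves both as the start of
      -- the walk and as the bound on every increment.
      central-exists : ∀ {y₀ Y′} → Y ≡ y₀ ∷ Y′ → 3 * length (firsts y₀) ≤ 2 * length L → ∃[ z ] (z ∈ Y × Central z)
      central-exists {y₀} {Y′} Y≡ upper with length L ≤? 3 * length (firsts y₀)
      ... | yes lower = y₀ , subst (y₀ ∈_) (sym Y≡) (here refl) , lower , upper
      ... | no ¬lower = central-from (subst (y₀ ∈_) (sym Y≡) (here refl)) (≰⇒> ¬lower) [] y₀ Y′ Y≡ upper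

      balanced : ∀ {y₀ Y′} → Y ≡ y₀ ∷ Y′ → 3 * length (firsts y₀) ≤ 2 * length L → IsBalanced 𝒜
      balanced Y≡ upper with central-exists Y≡ upper
      ... | z , z∈Y , lower , upper′ = inj₁ (x , z , Element-x , Element-Y z∈Y , (λ { refl → x∉Y z∈Y }) ,
        L , firsts z , L-enum ,
        (filter⁺ (precedes? x z) (proj₁ L-enum) ,
         λ w → mk⇔ (λ w∈ → let w∈L , pr = ∈-filter⁻ (precedes? x z) {xs = L} w∈ in to (proj₂ L-enum w) w∈L , pr)
                   (λ (bw , pr) → ∈-filter⁺ (precedes? x z) (from (proj₂ L-enum w) bw) pr)) ,
        lower , upper′)

  -- No word without repetitions has `x` and `y` in both orders. This turns a large count for `x`
  -- before `y` into a small one for `y` before `x`.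
  precedes-count-≤ : ∀ {𝒜 : Family n} {L} → Enumerates (IsBasicWord 𝒜) L → ∀ x y →
    length (filter (precedes? x y) L) + length (filter (precedes? y x) L) ≤ length L
  precedes-count-≤ {𝒜} {L} (uL , enum) x y = subst (_≤ length L) (length-++ (filter (precedes? x y) L))
    (length-⊆ {vs = L} (Unique-++⁺ (filter⁺ _ uL) (filter⁺ _ uL) disjoint)
      ([ proj₁ ∘ ∈-filter⁻ (precedes? x y) , proj₁ ∘ ∈-filter⁻ (precedes? y x) ]′
        ∘ ∈-++⁻ (filter (precedes? x y) L)))
    where
    disjoint : ∀ {w} → ¬ (w ∈ filter (precedes? x y) L × w ∈ filter (precedes? y x) L)
    disjoint {w} (w∈₁ , w∈₂) with ∈-filter⁻ (precedes? x y) {xs = L} w∈₁ | ∈-filter⁻ (precedes? y x) {xs = L} w∈₂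
    ... | w∈L , pr₁ | _ , pr₂ = precedes-asym (proj₁ (to (enum w) w∈L)) pr₁ pr₂

-- Combining the two sides

theorem4 : (n : ℕ) (𝒜 : Family n) → IsAntimatroid 𝒜 → ConvexDimensionTwo 𝒜
    → HasDoubleLadder 𝒜 × IsBalanced 𝒜
theorem4 n 𝒜 am@(∪-closed , _) ((𝒞₁ , 𝒞₂ , ch₁ , ch₂ , same) , not-chain)
  with join-spanned ∪-closed ch₁ ch₂ same
... | P , Q , bP , bQ , span with first-difference _≟_ (basic⇒Unique bP) (basic⇒Unique bQ) (basic-≋ bP bQ)
...   | inj₁ refl = contradiction (𝒜 , spanned-diagonal⇒chain am bP span , λ _ → mk⇔ id id) not-chain
...   | inj₂ (c , x , y , P′ , Q′ , P≡ , Q≡ , x≢y)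
  with later bP P≡ Q≡ x≢y (proj₁ (basic-≋ bP bQ)) | later bQ Q≡ P≡ (x≢y ∘ sym) (proj₂ (basic-≋ bP bQ))
  where
  -- `x` occurs in `Q`, but neither in `c` nor at the place of `y`, so it comes after `y`.
  later : ∀ {P Q c x y P′ Q′} → IsBasicWord 𝒜 P → P ≡ c ++ x ∷ P′ → Q ≡ c ++ y ∷ Q′ → x ≢ y → P ⊆ Q →
    ∃[ Y ] ∃[ Q″ ] (Q ≡ c ++ (y ∷ Y) ++ x ∷ Q″)
  later {c = c} {x} {y} bP P≡ Q≡ x≢y P⊆Q
    with ∈-++⁻ c (subst (x ∈_) Q≡ (P⊆Q (subst (x ∈_) (sym P≡) (∈-insert c))))
  ... | inj₁ x∈c = contradiction x∈c (Unique-middle c (subst Unique P≡ (basic⇒Unique bP)))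
  ... | inj₂ (here refl) = contradiction refl x≢y
  ... | inj₂ (there x∈Q′) with ∈-∃++ x∈Q′
  ...   | Y , Q″ , refl = Y , Q″ , Q≡
...     | Y , Q″ , Q≡′ | X , P″ , P≡′ =
  (x ∷ X , y ∷ Y , X-side.ladder (λ ()) , Y-side.ladder (λ ())) , bal
  where
  -- The second instance exchanges the two words and the two letters. Each stretch begins with the
  -- letter that the other ladder is built on, as a double ladder demands.
  module X-side = OneSide ∪-closed bP bQ span c x P′ (y ∷ Y) Q″ P≡ Q≡′
  module Y-side = OneSide ∪-closed bQ bP (Spanned-sym ∘ span) c y Q′ (x ∷ X) P″ Q≡ P≡′
  bal : IsBalanced 𝒜
  bal with basic-enumeration ∪-closed bP bQ span
  ... | L , L-enum with 3 * length (filter (precedes? x y) L) ≤? 2 * length L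
  ...   | yes small = X-side.Count.balanced L-enum refl small
  -- With N basic words, `large` says 3F > 2N, while F + G is at most N. The bound 3N is relaxed to
  -- 4N so that cancelling 2N leaves 3G ≤ 2N, the form that `balanced` takes.
  ...   | no  large = Y-side.Count.balanced L-enum refl (+-cancelˡ-≤ (2 * length L) _ _ (begin
    2 * length L + 3 * G  ≤⟨ +-monoˡ-≤ (3 * G) (<⇒≤ (≰⇒> large)) ⟩
    3 * F + 3 * G         ≡⟨ *-distribˡ-+ 3 F G ⟨
    3 * (F + G)           ≤⟨ *-monoʳ-≤ 3 (precedes-count-≤ L-enum x y) ⟩
    3 * length L          ≤⟨ *-monoˡ-≤ (length L) (n≤1+n 3) ⟩
    4 * length L          ≡⟨ *-distribʳ-+ (length L) 2 2 ⟩
    2 * length L + 2 * length L ∎))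
    where
    open ≤-Reasoning
    F = length (filter (precedes? x y) L)
    G = length (filter (precedes? y x) L)
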